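{- Let $R$ be a binary relation on a set $A$. If $\mathbf{WN}(R)$ and $\mathbf{UN}^{\to}(R)$ hold, then $\mathbf{BP}(R)$ holds: every $R$-increasing sequence is bounded. (Constructively.)
   Context: Work in constructive (intuitionistic) logic / Martin-Löf type theory without excluded middle or other axioms. Let $R$ be a binary relation on $A$; write $a\to b$ for $R\,a\,b$, $\to^*$ for its reflexive–transitive closure, $\equiv$ for identity. $a\in\mathrm{NF}$ iff there is no $b$ with $a\to b$. $\mathbf{WN}(R)$: every $a\in A$ has some $b\in\mathrm{NF}$ with $a\to^* b$. $\mathbf{UN}^{\to}(R)$: for all $a\in A$ and $b,c\in\mathrm{NF}$, $a\to^* b$ and $a\to^* c$ imply $b\equiv c$. A sequence $s:\mathbb{N}\to A$ is $R$-increasing if $s(k)\to s(k+1)$ for all $k$; it is bounded if there is $b\in A$ with $s(i)\to^* b$ for all $i$. $\mathbf{BP}(R)$: every $R$-increasing sequence is bounded. -}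

module Defs where

open import Data.Nat.Base using (ℕ; suc)
open import Data.Product.Base using (∃)
open import Level using (_⊔_)
open import Relation.Binary.Core using (Rel)
open import Relation.Binary.Construct.Closure.ReflexiveTransitive using (Star)
open import Relation.Binary.PropositionalEquality.Core using (_≡_)
open import Relation.Binary.Rewriting using (IsNormalForm)

module _ {a ℓ} {A : Set a} (_⟶_ : Rel A ℓ) where

  private
    _—↠_ = Star _⟶_

  -- Weaker than UniqueNormalForm from Relation.Binary.Rewriting, which asks
  -- for convertible normal forms to be equal: here the two normal forms must
  -- be reducts of a common element.
  UniqueNormalForm→ : Set (a ⊔ ℓ)
  UniqueNormalForm→ = ∀ {x y z} → IsNormalForm _⟶_ y → IsNormalForm _⟶_ z →
                      x —↠ y → x —↠ z → y ≡ z

  Increasing : (ℕ → A) → Set ℓ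
  Increasing s = ∀ k → s k ⟶ s (suc k)

  Bounded : (ℕ → A) → Set (a ⊔ ℓ)
  Bounded s = ∃ λ b → ∀ i → s i —↠ b

  BoundedProperty : Set (a ⊔ ℓ)
  BoundedProperty = ∀ s → Increasing s → Bounded s

{-# OPTIONS --safe #-}
module Submission where

open import Defs
open import Data.Nat.Base using (zero; suc)
open import Data.Product.Base using (_,_)
open import Relation.Binary.Construct.Closure.ReflexiveTransitive using (Star; ε; _◅_; _◅◅_)
open import Relation.Binary.Core using (Rel)
open import Relation.Binary.PropositionalEquality.Core using (subst)
open import Relation.Binary.Rewriting using (WeaklyNormalizing)

-- Every `s i` is a reduct of `s zero`, so the normal form that weak normalization gives for `s i`
-- is also reached from `s zero`. Uniqueness there forces all these normal forms to coincide, and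
-- the common value bounds the sequence.

increasing⇒initial-reduces : ∀ {a ℓ} {A : Set a} (R : Rel A ℓ) {s} →
    Increasing R s → ∀ i → Star R (s zero) (s i)
increasing⇒initial-reduces R inc zero    = ε
increasing⇒initial-reduces R inc (suc i) =
  increasing⇒initial-reduces R inc i ◅◅ inc i ◅ ε

-- The bound is a normal form of s 0: a normal form of any s i is also one of s 0.
theorem1p2p3 : ∀ {a ℓ} {A : Set a} (R : Rel A ℓ) →
    WeaklyNormalizing R → UniqueNormalForm→ R → BoundedProperty R
theorem1p2p3 R wn un s inc with wn (s zero)
... | b , b-nf , s0↠b = b , bounded
  where
  bounded : ∀ i → Star R (s i) b
  bounded i with wn (s i)
  ... | c , c-nf , si↠c =
    -- The common source that `un` requires is `s zero`, which reaches `c` through `s i`; the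
    -- resulting `c ≡ b` turns `si↠c` into a reduction to `b`.
    subst (Star R (s i))
      (un c-nf b-nf (increasing⇒initial-reduces R inc i ◅◅ si↠c) s0↠b) si↠c
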